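{- Let $n\ge3$, $\varphi\in S_n$, and let $k,l$ be two different blocks of $\mathfrak{M}_{(n,\varphi)}$. Then $|k\cap l|\in\{0,1,2,n-2\}$. If both $k,l$ are $A$-blocks, or both $k,l$ are $B$-blocks, then $|k\cap l|=n-2$. Otherwise (up to interchanging $k$ and $l$) $k=A_i$ and $l=B_j$ for some $i,j\in I$, and the following equivalences hold: (i) $|A_i\cap B_j|=0$ iff $\varphi(j)=i=j$; (ii) $|A_i\cap B_j|=1$ iff ($\varphi(j)=i\neq j$ or $\varphi(j)\neq i=j$); (iii) $|A_i\cap B_j|=2$ iff ($\varphi(j)\neq i$ and $i\neq j$).
   Context: Let $n\ge 3$, $I=\{1,\dots,n\}$, $\varphi\in S_n$ a permutation of $I$, and let $A=\{a_1,\dots,a_n\}$, $B=\{b_1,\dots,b_n\}$ be disjoint $n$-element sets. For $i\in I$ put $A_i=(A\setminus\{a_i\})\cup\{b_i\}$ (the $A$-blocks) and $B_i=(B\setminus\{b_i\})\cup\{a_{\varphi(i)}\}$ (the $B$-blocks). The Möbius $n$-pair $\mathfrak{M}_{(n,\varphi)}$ is the point-block structure with point set $A\cup B$ and block set $\{A_i: i\in I\}\cup\{B_i: i\in I\}$. -}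

module Defs where

open import Data.Fin.Base using (Fin; zero; suc)
open import Data.Fin.Permutation using (Permutation′; _⟨$⟩ʳ_)
open import Data.Fin.Subset using (Subset; ⁅_⁆; _∪_; _-_; ⋃; _⊆_; _∈_)
open import Data.Fin.Subset.Properties
  using (p⊆p∪q; q⊆p∪q; x∈p∪q⁻; x∈⁅x⁆; x∈⁅y⁆⇒x≡y; p─q⊆p)
open import Data.List.Base using (tabulate)
open import Data.Nat.Base using (ℕ)
open import Data.Product.Base using (∃; _,_)
open import Data.Sum.Base using (_⊎_; inj₁; inj₂)
open import Function.Base using (_∘_)
open import Function.Definitions using (Injective)
open import Relation.Binary.PropositionalEquality using (_≡_; _≢_; refl)

private
  variable
    m n : ℕ

image : (Fin n → Fin m) → Subset m
image f = ⋃ (tabulate (⁅_⁆ ∘ f))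

∈-image : (f : Fin n → Fin m) (i : Fin n) → f i ∈ image f
∈-image f zero    = p⊆p∪q _ (x∈⁅x⁆ (f zero))
∈-image f (suc i) = q⊆p∪q _ _ (∈-image (f ∘ suc) i)

-- The points live in an ambient finite set Fin m, whose elements need not
-- all be points.
record PointBlockStructure (m : ℕ) : Set₁ where
  field
    points       : Subset m
    Block        : Subset m → Set
    block⊆points : ∀ {k} → Block k → k ⊆ points

-- Two disjoint n-element subsets {a₁,…,aₙ} and {b₁,…,bₙ} of Fin m, with
-- their elements labelled by Fin n.
record DisjointPair (n m : ℕ) : Set where
  field
    a b         : Fin n → Fin m
    a-injective : Injective _≡_ _≡_ a
    b-injective : Injective _≡_ _≡_ b
    disjoint    : ∀ i j → a i ≢ b j

  A B : Subset m
  A = image a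
  B = image b

module MöbiusPair (φ : Permutation′ n) (S : DisjointPair n m) where
  open DisjointPair S public

  A-block B-block : Fin n → Subset m
  A-block i = (A - a i) ∪ ⁅ b i ⁆
  B-block i = (B - b i) ∪ ⁅ a (φ ⟨$⟩ʳ i) ⁆

  IsABlock IsBBlock : Subset m → Set
  IsABlock k = ∃ λ i → k ≡ A-block i
  IsBBlock k = ∃ λ i → k ≡ B-block i

  𝔐 : PointBlockStructure m
  𝔐 = record
    { points       = A ∪ B
    ; Block        = λ k → IsABlock k ⊎ IsBBlock k
    ; block⊆points = ⊆points
    }
    where
    ⊆points : ∀ {k} → IsABlock k ⊎ IsBBlock k → k ⊆ A ∪ B
    ⊆points (inj₁ (i , refl)) x∈ with x∈p∪q⁻ (A - a i) ⁅ b i ⁆ x∈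
    ... | inj₁ x∈A- = p⊆p∪q B (p─q⊆p A ⁅ a i ⁆ x∈A-)
    ... | inj₂ x∈b  rewrite x∈⁅y⁆⇒x≡y (b i) x∈b = q⊆p∪q A B (∈-image b i)
    ⊆points (inj₂ (i , refl)) x∈ with x∈p∪q⁻ (B - b i) ⁅ a (φ ⟨$⟩ʳ i) ⁆ x∈
    ... | inj₁ x∈B- = q⊆p∪q A B (p─q⊆p B ⁅ b i ⁆ x∈B-)
    ... | inj₂ x∈a  rewrite x∈⁅y⁆⇒x≡y (a (φ ⟨$⟩ʳ i)) x∈a =
      p⊆p∪q B (∈-image a (φ ⟨$⟩ʳ i))

  open PointBlockStructure 𝔐 public

{-# OPTIONS --safe #-}
-- The intersection of two A-blocks A_i ≠ A_j is A with a_i and a_j removed, because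
-- b_i and b_j differ and lie outside A; the B-blocks are symmetric, with a ∘ φ in the
-- role of b. A point common to A_i and B_j is either a_φ(j), which survives exactly
-- when φ(j) ≠ i, or b_i, which survives exactly when i ≠ j.
module Submission where

open import Defs
open import Data.Fin.Base using (Fin; zero; suc)
open import Data.Fin.Permutation using (Permutation′; _⟨$⟩ʳ_)
open import Data.Fin.Properties using (_≟_; 0≢1+n; suc-injective)
open import Data.Fin.Subset
  using (Subset; inside; outside; ⁅_⁆; _∪_; _∩_; _-_; ∣_∣; _⊆_; Empty)
  renaming (_∈_ to _∈ₛ_; _∉_ to _∉ₛ_)
open import Data.Fin.Subset.Properties
open import Data.List.Base using ([]; _∷_)
open import Data.List.Membership.Propositional using (_∈_)
open import Data.List.Relation.Unary.Any using (here; there)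
open import Data.Nat.Base using (ℕ; zero; suc; _≤_; _∸_)
open import Data.Product.Base using (∃; ∃₂; _×_; _,_; proj₂)
open import Data.Sum.Base using (_⊎_; inj₁; inj₂)
open import Data.Vec.Base using (_∷_; here; there)
open import Function.Base using (_∘_)
open import Function.Bundles using (_⇔_; mk⇔; module Injection)
open import Function.Definitions using (Injective)
open import Function.Properties.Inverse using (↔⇒↣)
open import Relation.Binary.PropositionalEquality
  using (_≡_; _≢_; refl; sym; trans; cong; subst)
open import Relation.Nullary using (¬_; yes; no; contradiction)

private
  variable
    n m : ℕ

-- Cardinalities of subsets and of images.

-- The singleton stands on the left because that is how `image` unfolds at a successor.
x∉p⇒∣⁅x⁆∪p∣≡1+∣p∣ : (x : Fin m) (p : Subset m) → x ∉ₛ p → ∣ ⁅ x ⁆ ∪ p ∣ ≡ suc ∣ p ∣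
x∉p⇒∣⁅x⁆∪p∣≡1+∣p∣ zero    (inside  ∷ p) x∉p = contradiction here x∉p
x∉p⇒∣⁅x⁆∪p∣≡1+∣p∣ zero    (outside ∷ p) x∉p = cong (suc ∘ ∣_∣) (∪-identityˡ p)
x∉p⇒∣⁅x⁆∪p∣≡1+∣p∣ (suc x) (inside  ∷ p) x∉p =
  cong suc (x∉p⇒∣⁅x⁆∪p∣≡1+∣p∣ x p (x∉p ∘ there))
x∉p⇒∣⁅x⁆∪p∣≡1+∣p∣ (suc x) (outside ∷ p) x∉p = x∉p⇒∣⁅x⁆∪p∣≡1+∣p∣ x p (x∉p ∘ there)

x∉p-x : (x : Fin m) (p : Subset m) → x ∉ₛ p - x
x∉p-x zero    (_ ∷ p) ()
x∉p-x (suc x) (_ ∷ p) (there x∈) = x∉p-x x p x∈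

x∈p-y⇒x≢y : ∀ {x : Fin m} (p : Subset m) y → x ∈ₛ p - y → x ≢ y
x∈p-y⇒x≢y p y x∈ refl = x∉p-x y p x∈

x∈p⇒⁅x⁆∪[p-x]≡p : ∀ {x : Fin m} {p} → x ∈ₛ p → ⁅ x ⁆ ∪ (p - x) ≡ p
x∈p⇒⁅x⁆∪[p-x]≡p {x = x} {p} x∈p = ⊆-antisym to from
  where
  to : ⁅ x ⁆ ∪ (p - x) ⊆ p
  to y∈ with x∈p∪q⁻ ⁅ x ⁆ (p - x) y∈
  ... | inj₁ y∈x rewrite x∈⁅y⁆⇒x≡y x y∈x = x∈p
  ... | inj₂ y∈- = p─q⊆p p ⁅ x ⁆ y∈-

  from : p ⊆ ⁅ x ⁆ ∪ (p - x)
  from {y} y∈ with y ≟ x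
  ... | yes refl = x∈p∪q⁺ (inj₁ (x∈⁅x⁆ x))
  ... | no  y≢x  = x∈p∪q⁺ (inj₂ (x∈p∧x≢y⇒x∈p-y y∈ y≢x))

-- Putting `x` back restores `p`, and inserting a fresh element adds one. The form with `suc` avoids
-- truncated subtraction and chains over repeated removals.
x∈p⇒1+∣p-x∣≡∣p∣ : ∀ {x : Fin m} {p} → x ∈ₛ p → suc ∣ p - x ∣ ≡ ∣ p ∣
x∈p⇒1+∣p-x∣≡∣p∣ {x = x} {p} x∈p =
  trans (sym (x∉p⇒∣⁅x⁆∪p∣≡1+∣p∣ x (p - x) (x∉p-x x p)))
        (cong ∣_∣ (x∈p⇒⁅x⁆∪[p-x]≡p x∈p))

x≢y⇒∣⁅x⁆∪⁅y⁆∣≡2 : ∀ {x y : Fin m} → x ≢ y → ∣ ⁅ x ⁆ ∪ ⁅ y ⁆ ∣ ≡ 2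
x≢y⇒∣⁅x⁆∪⁅y⁆∣≡2 {x = x} {y} x≢y =
  trans (x∉p⇒∣⁅x⁆∪p∣≡1+∣p∣ x ⁅ y ⁆ (x≢y⇒x∉⁅y⁆ x≢y)) (cong suc (∣⁅x⁆∣≡1 y))

∈-image⁻ : (f : Fin n → Fin m) → ∀ {x} → x ∈ₛ image f → ∃ λ i → x ≡ f i
∈-image⁻ {zero}  f x∈ = contradiction x∈ ∉⊥
∈-image⁻ {suc n} f x∈ with x∈p∪q⁻ ⁅ f zero ⁆ (image (f ∘ suc)) x∈
... | inj₁ x∈f0 = zero , x∈⁅y⁆⇒x≡y (f zero) x∈f0
... | inj₂ x∈im with ∈-image⁻ (f ∘ suc) x∈im
...   | i , x≡fi = suc i , x≡fi

-- By induction: injectivity keeps `f zero` out of the image of `f ∘ suc`, so each index contributes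
-- one new element.
∣image∣ : (f : Fin n → Fin m) → Injective _≡_ _≡_ f → ∣ image f ∣ ≡ n
∣image∣ {zero}  {m} f inj = ∣⊥∣≡0 m
∣image∣ {suc n} f inj =
  trans (x∉p⇒∣⁅x⁆∪p∣≡1+∣p∣ (f zero) (image (f ∘ suc)) f0∉)
        (cong suc (∣image∣ (f ∘ suc) (suc-injective ∘ inj)))
  where
  f0∉ : f zero ∉ₛ image (f ∘ suc)
  f0∉ f0∈ = 0≢1+n (inj (proj₂ (∈-image⁻ (f ∘ suc) f0∈)))

-- Replacing one element of an image by a new point.

-- The common shape of both kinds of block: by unfolding, `A-block i` is `exchange a i (b i)` and
-- `B-block i` is `exchange b i (a (φ ⟨$⟩ʳ i))`. Blocks of either kind are thus treated by the same
-- lemmas.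
exchange : (Fin n → Fin m) → Fin n → Fin m → Subset m
exchange f i x = (image f - f i) ∪ ⁅ x ⁆

module _ (f : Fin n → Fin m) where

  -- Passing from `f t ≢ f i` to `t ≢ i` is congruence; the way back, in `old∈exchange`, takes
  -- injectivity.
  ∈-exchange⁻ : ∀ {y} i x → y ∈ₛ exchange f i x → (∃ λ t → t ≢ i × y ≡ f t) ⊎ y ≡ x
  ∈-exchange⁻ i x y∈ with x∈p∪q⁻ (image f - f i) ⁅ x ⁆ y∈
  ... | inj₂ y∈x = inj₂ (x∈⁅y⁆⇒x≡y x y∈x)
  ... | inj₁ y∈- with ∈-image⁻ f (p─q⊆p (image f) ⁅ f i ⁆ y∈-)
  ...   | t , refl = inj₁ (t , x∈p-y⇒x≢y (image f) (f i) y∈- ∘ cong f , refl)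

  new∈exchange : ∀ i x → x ∈ₛ exchange f i x
  new∈exchange i x = x∈p∪q⁺ (inj₂ (x∈⁅x⁆ x))

  module _ (f-injective : Injective _≡_ _≡_ f) where

    old∈exchange : ∀ {t i} x → t ≢ i → f t ∈ₛ exchange f i x
    old∈exchange {t} x t≢i =
      x∈p∪q⁺ (inj₁ (x∈p∧x≢y⇒x∈p-y (∈-image f t) (t≢i ∘ f-injective)))

    -- A common point is old or new on each side. Old against new fails because `x` and `y` lie
    -- outside the image, new against new because `x ≢ y`; only points that are old on both sides
    -- remain.
    exchange∩exchange : ∀ {i j x y} → x ≢ y → (∀ t → f t ≢ x) → (∀ t → f t ≢ y) →
      exchange f i x ∩ exchange f j y ≡ image f - f i - f j
    exchange∩exchange {i} {j} {x} {y} x≢y f≢x f≢y = ⊆-antisym to from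
      where
      to : exchange f i x ∩ exchange f j y ⊆ image f - f i - f j
      to z∈ with x∈p∩q⁻ (exchange f i x) (exchange f j y) z∈
      ... | z∈ˡ , z∈ʳ with ∈-exchange⁻ i x z∈ˡ | ∈-exchange⁻ j y z∈ʳ
      -- The same point carries the labels `t` and `u`; the condition on `u` is carried over to
      -- `f t` through `f t ≡ f u`.
      ...   | inj₁ (t , t≢i , refl) | inj₁ (u , u≢j , ft≡fu) =
        x∈p∧x≢y⇒x∈p-y (x∈p∧x≢y⇒x∈p-y (∈-image f t) (t≢i ∘ f-injective))
          (λ ft≡fj → u≢j (f-injective (trans (sym ft≡fu) ft≡fj)))
      ...   | inj₁ (t , _ , refl)   | inj₂ ft≡y           = contradiction ft≡y (f≢y t)
      ...   | inj₂ refl             | inj₁ (u , _ , x≡fu) = contradiction (sym x≡fu) (f≢x u)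
      ...   | inj₂ refl             | inj₂ x≡y            = contradiction x≡y x≢y

      from : image f - f i - f j ⊆ exchange f i x ∩ exchange f j y
      from z∈ with p─q⊆p (image f - f i) ⁅ f j ⁆ z∈
      ... | z∈-i = x∈p∩q⁺
        ( x∈p∪q⁺ (inj₁ z∈-i)
        , x∈p∪q⁺ (inj₁ (x∈p∧x≢y⇒x∈p-y (p─q⊆p (image f) ⁅ f i ⁆ z∈-i)
                                      (x∈p-y⇒x≢y (image f - f i) (f j) z∈)))
        )

    -- Both removals lower the size by one: `f i` lies in the image, and `f j` is still there after
    -- `f i` is gone because `i ≢ j`.
    ∣exchange∩exchange∣ : ∀ {i j x y} → i ≢ j → x ≢ y → (∀ t → f t ≢ x) → (∀ t → f t ≢ y) →
      ∣ exchange f i x ∩ exchange f j y ∣ ≡ n ∸ 2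
    ∣exchange∩exchange∣ {i} {j} i≢j x≢y f≢x f≢y =
      -- `suc (suc c) ∸ 2` computes to `c`, so applying `_∸ 2` to the additive count gives the
      -- claim.
      trans (cong ∣_∣ (exchange∩exchange x≢y f≢x f≢y)) (cong (_∸ 2) 2+∣∣≡n)
      where
      fj∈ : f j ∈ₛ image f - f i
      fj∈ = x∈p∧x≢y⇒x∈p-y (∈-image f j) (i≢j ∘ sym ∘ f-injective)

      2+∣∣≡n : suc (suc ∣ image f - f i - f j ∣) ≡ n
      2+∣∣≡n = trans (cong suc (x∈p⇒1+∣p-x∣≡∣p∣ fj∈))
        (trans (x∈p⇒1+∣p-x∣≡∣p∣ (∈-image f i)) (∣image∣ f f-injective))

-- Intersections of blocks.

module _ (φ : Permutation′ n) (S : DisjointPair n m) where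
  open MöbiusPair φ S

  private
    a∘φ : Fin n → Fin m
    a∘φ = a ∘ (φ ⟨$⟩ʳ_)

    -- The injectivity of `φ` enters here: different B-blocks must bring in different points of `A`.
    a∘φ-injective : Injective _≡_ _≡_ a∘φ
    a∘φ-injective = Injection.injective (↔⇒↣ φ) ∘ a-injective

  ∣A-block∩A-block∣ : ∀ {i j} → i ≢ j → ∣ A-block i ∩ A-block j ∣ ≡ n ∸ 2
  ∣A-block∩A-block∣ {i} {j} i≢j = ∣exchange∩exchange∣ a a-injective i≢j
    (i≢j ∘ b-injective) (λ t → disjoint t i) (λ t → disjoint t j)

  ∣B-block∩B-block∣ : ∀ {i j} → i ≢ j → ∣ B-block i ∩ B-block j ∣ ≡ n ∸ 2
  ∣B-block∩B-block∣ {i} {j} i≢j = ∣exchange∩exchange∣ b b-injective i≢j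
    (i≢j ∘ a∘φ-injective) (λ t → disjoint _ t ∘ sym) (λ t → disjoint _ t ∘ sym)

  module _ (i j : Fin n) where

    -- Old on both sides or new on both sides would put one point in both `A` and `B`. A point old
    -- on one side and new on the other has its index fixed by injectivity, so the condition of not
    -- being the deleted index becomes `φ ⟨$⟩ʳ j ≢ i` or `i ≢ j`.
    ∈-A-block∩B-block⁻ : ∀ {x} → x ∈ₛ A-block i ∩ B-block j →
      (φ ⟨$⟩ʳ j ≢ i × x ≡ a∘φ j) ⊎ (i ≢ j × x ≡ b i)
    ∈-A-block∩B-block⁻ x∈ with x∈p∩q⁻ (A-block i) (B-block j) x∈
    ... | x∈A , x∈B with ∈-exchange⁻ a i (b i) x∈A | ∈-exchange⁻ b j (a∘φ j) x∈B
    ...   | inj₁ (t , t≢i , refl) | inj₁ (u , _ , at≡bu)   = contradiction at≡bu (disjoint t u)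
    ...   | inj₁ (t , t≢i , refl) | inj₂ at≡aφj            =
      inj₁ (subst (_≢ i) (a-injective at≡aφj) t≢i , at≡aφj)
    ...   | inj₂ refl             | inj₁ (u , u≢j , bi≡bu) =
      inj₂ (subst (_≢ j) (b-injective (sym bi≡bu)) u≢j , refl)
    ...   | inj₂ refl             | inj₂ bi≡aφj            =
      contradiction (sym bi≡aφj) (disjoint _ i)

    aφj∈A-block∩B-block : φ ⟨$⟩ʳ j ≢ i → a∘φ j ∈ₛ A-block i ∩ B-block j
    aφj∈A-block∩B-block φj≢i =
      x∈p∩q⁺ (old∈exchange a a-injective (b i) φj≢i , new∈exchange b j (a∘φ j))

    bi∈A-block∩B-block : i ≢ j → b i ∈ₛ A-block i ∩ B-block j
    bi∈A-block∩B-block i≢j =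
      x∈p∩q⁺ (new∈exchange a i (b i) , old∈exchange b b-injective (a∘φ j) i≢j)

    ∣A-block∩B-block∣≡0 : φ ⟨$⟩ʳ j ≡ i → i ≡ j → ∣ A-block i ∩ B-block j ∣ ≡ 0
    ∣A-block∩B-block∣≡0 φj≡i i≡j = trans (cong ∣_∣ (Empty-unique empty)) (∣⊥∣≡0 m)
      where
      empty : Empty (A-block i ∩ B-block j)
      empty (x , x∈) with ∈-A-block∩B-block⁻ x∈
      ... | inj₁ (φj≢i , _) = φj≢i φj≡i
      ... | inj₂ (i≢j , _)  = i≢j i≡j

    A-block∩B-block≡⁅aφj⁆ : φ ⟨$⟩ʳ j ≢ i → i ≡ j → A-block i ∩ B-block j ≡ ⁅ a∘φ j ⁆
    A-block∩B-block≡⁅aφj⁆ φj≢i i≡j = ⊆-antisym to from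
      where
      to : A-block i ∩ B-block j ⊆ ⁅ a∘φ j ⁆
      to x∈ with ∈-A-block∩B-block⁻ x∈
      ... | inj₁ (_ , refl) = x∈⁅x⁆ _
      ... | inj₂ (i≢j , _)  = contradiction i≡j i≢j

      from : ⁅ a∘φ j ⁆ ⊆ A-block i ∩ B-block j
      from x∈ rewrite x∈⁅y⁆⇒x≡y _ x∈ = aφj∈A-block∩B-block φj≢i

    A-block∩B-block≡⁅bi⁆ : φ ⟨$⟩ʳ j ≡ i → i ≢ j → A-block i ∩ B-block j ≡ ⁅ b i ⁆
    A-block∩B-block≡⁅bi⁆ φj≡i i≢j = ⊆-antisym to from
      where
      to : A-block i ∩ B-block j ⊆ ⁅ b i ⁆
      to x∈ with ∈-A-block∩B-block⁻ x∈
      ... | inj₁ (φj≢i , _) = contradiction φj≡i φj≢i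
      ... | inj₂ (_ , refl) = x∈⁅x⁆ _

      from : ⁅ b i ⁆ ⊆ A-block i ∩ B-block j
      from x∈ rewrite x∈⁅y⁆⇒x≡y _ x∈ = bi∈A-block∩B-block i≢j

    A-block∩B-block≡⁅aφj⁆∪⁅bi⁆ : φ ⟨$⟩ʳ j ≢ i → i ≢ j →
      A-block i ∩ B-block j ≡ ⁅ a∘φ j ⁆ ∪ ⁅ b i ⁆
    A-block∩B-block≡⁅aφj⁆∪⁅bi⁆ φj≢i i≢j = ⊆-antisym to from
      where
      to : A-block i ∩ B-block j ⊆ ⁅ a∘φ j ⁆ ∪ ⁅ b i ⁆
      to x∈ with ∈-A-block∩B-block⁻ x∈
      ... | inj₁ (_ , refl) = x∈p∪q⁺ (inj₁ (x∈⁅x⁆ _))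
      ... | inj₂ (_ , refl) = x∈p∪q⁺ (inj₂ (x∈⁅x⁆ _))

      from : ⁅ a∘φ j ⁆ ∪ ⁅ b i ⁆ ⊆ A-block i ∩ B-block j
      from x∈ with x∈p∪q⁻ ⁅ a∘φ j ⁆ ⁅ b i ⁆ x∈
      ... | inj₁ x∈a rewrite x∈⁅y⁆⇒x≡y _ x∈a = aφj∈A-block∩B-block φj≢i
      ... | inj₂ x∈b rewrite x∈⁅y⁆⇒x≡y _ x∈b = bi∈A-block∩B-block i≢j

    ∣A-block∩B-block∣≡1 :
      ((φ ⟨$⟩ʳ j ≡ i) × (i ≢ j)) ⊎ ((φ ⟨$⟩ʳ j ≢ i) × (i ≡ j)) →
      ∣ A-block i ∩ B-block j ∣ ≡ 1
    ∣A-block∩B-block∣≡1 (inj₁ (φj≡i , i≢j)) =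
      trans (cong ∣_∣ (A-block∩B-block≡⁅bi⁆ φj≡i i≢j)) (∣⁅x⁆∣≡1 (b i))
    ∣A-block∩B-block∣≡1 (inj₂ (φj≢i , i≡j)) =
      trans (cong ∣_∣ (A-block∩B-block≡⁅aφj⁆ φj≢i i≡j)) (∣⁅x⁆∣≡1 (a∘φ j))

    ∣A-block∩B-block∣≡2 : φ ⟨$⟩ʳ j ≢ i → i ≢ j → ∣ A-block i ∩ B-block j ∣ ≡ 2
    ∣A-block∩B-block∣≡2 φj≢i i≢j =
      trans (cong ∣_∣ (A-block∩B-block≡⁅aφj⁆∪⁅bi⁆ φj≢i i≢j))
            -- The two surviving points are distinct because one lies in `A` and the other in `B`.
            (x≢y⇒∣⁅x⁆∪⁅y⁆∣≡2 (disjoint _ i))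

    -- The four outcomes of two decidable equalities are grouped by how many of the candidates
    -- `a∘φ j` and `b i` survive: none, exactly one, or both. These groups match the sizes 0, 1 and
    -- 2.
    coincidence-cases :
      ((φ ⟨$⟩ʳ j ≡ i) × (i ≡ j)) ⊎
      (((φ ⟨$⟩ʳ j ≡ i) × (i ≢ j)) ⊎ ((φ ⟨$⟩ʳ j ≢ i) × (i ≡ j))) ⊎
      ((φ ⟨$⟩ʳ j ≢ i) × (i ≢ j))
    coincidence-cases with (φ ⟨$⟩ʳ j) ≟ i | i ≟ j
    ... | yes φj≡i | yes i≡j = inj₁ (φj≡i , i≡j)
    ... | yes φj≡i | no  i≢j = inj₂ (inj₁ (inj₁ (φj≡i , i≢j)))
    ... | no  φj≢i | yes i≡j = inj₂ (inj₁ (inj₂ (φj≢i , i≡j)))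
    ... | no  φj≢i | no  i≢j = inj₂ (inj₂ (φj≢i , i≢j))

    ∣A-block∩B-block∣∈ : ∣ A-block i ∩ B-block j ∣ ∈ 0 ∷ 1 ∷ 2 ∷ (n ∸ 2) ∷ []
    ∣A-block∩B-block∣∈ with coincidence-cases
    ... | inj₁ (φj≡i , i≡j)        = here (∣A-block∩B-block∣≡0 φj≡i i≡j)
    ... | inj₂ (inj₁ c)            = there (here (∣A-block∩B-block∣≡1 c))
    ... | inj₂ (inj₂ (φj≢i , i≢j)) = there (there (here (∣A-block∩B-block∣≡2 φj≢i i≢j)))

-- Implications from an exhaustive list of cases to pairwise different values
-- reverse automatically.
values⇒equivalences : ∀ {P₀ P₁ P₂ : Set} {c : ℕ} → P₀ ⊎ P₁ ⊎ P₂ →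
  (P₀ → c ≡ 0) → (P₁ → c ≡ 1) → (P₂ → c ≡ 2) →
  ((c ≡ 0) ⇔ P₀) × ((c ≡ 1) ⇔ P₁) × ((c ≡ 2) ⇔ P₂)
values⇒equivalences {P₀} {P₁} {P₂} {c} cases f₀ f₁ f₂ =
  mk⇔ (to₀ cases) f₀ , mk⇔ (to₁ cases) f₁ , mk⇔ (to₂ cases) f₂
  where
  to₀ : P₀ ⊎ P₁ ⊎ P₂ → c ≡ 0 → P₀
  to₀ (inj₁ p)        _   = p
  to₀ (inj₂ (inj₁ p)) c≡0 with () ← trans (sym c≡0) (f₁ p)
  to₀ (inj₂ (inj₂ p)) c≡0 with () ← trans (sym c≡0) (f₂ p)

  to₁ : P₀ ⊎ P₁ ⊎ P₂ → c ≡ 1 → P₁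
  to₁ (inj₁ p)        c≡1 with () ← trans (sym c≡1) (f₀ p)
  to₁ (inj₂ (inj₁ p)) _   = p
  to₁ (inj₂ (inj₂ p)) c≡1 with () ← trans (sym c≡1) (f₂ p)

  to₂ : P₀ ⊎ P₁ ⊎ P₂ → c ≡ 2 → P₂
  to₂ (inj₁ p)        c≡2 with () ← trans (sym c≡2) (f₀ p)
  to₂ (inj₂ (inj₁ p)) c≡2 with () ← trans (sym c≡2) (f₁ p)
  to₂ (inj₂ (inj₂ p)) _   = p

proposition1p2 : (n m : ℕ) → 3 ≤ n → (φ : Permutation′ n) (S : DisjointPair n m) →
    let open MöbiusPair φ S in
    ((k l : Subset m) → Block k → Block l → k ≢ l →
    (∣ k ∩ l ∣ ∈ 0 ∷ 1 ∷ 2 ∷ (n ∸ 2) ∷ []) ×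
    ((IsABlock k × IsABlock l) ⊎ (IsBBlock k × IsBBlock l) → ∣ k ∩ l ∣ ≡ n ∸ 2) ×
    (¬ ((IsABlock k × IsABlock l) ⊎ (IsBBlock k × IsBBlock l)) →
    ∃₂ λ i j → (k ≡ A-block i × l ≡ B-block j) ⊎ (l ≡ A-block i × k ≡ B-block j)))
    ×
    ((i j : Fin n) →
    ((∣ A-block i ∩ B-block j ∣ ≡ 0) ⇔ ((φ ⟨$⟩ʳ j ≡ i) × (i ≡ j))) ×
    ((∣ A-block i ∩ B-block j ∣ ≡ 1) ⇔
    (((φ ⟨$⟩ʳ j ≡ i) × (i ≢ j)) ⊎ ((φ ⟨$⟩ʳ j ≢ i) × (i ≡ j)))) ×
    ((∣ A-block i ∩ B-block j ∣ ≡ 2) ⇔ ((φ ⟨$⟩ʳ j ≢ i) × (i ≢ j))))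
proposition1p2 n m _ φ S =
  (λ k l k-block l-block k≢l →
    size k l k-block l-block k≢l , same-kind k l k≢l , mixed k l k-block l-block) ,
  (λ i j → values⇒equivalences (coincidence-cases φ S i j)
    (λ (φj≡i , i≡j) → ∣A-block∩B-block∣≡0 φ S i j φj≡i i≡j)
    (∣A-block∩B-block∣≡1 φ S i j)
    (λ (φj≢i , i≢j) → ∣A-block∩B-block∣≡2 φ S i j φj≢i i≢j))
  where
  open MöbiusPair φ S

  SameKind : Subset m → Subset m → Set
  SameKind k l = (IsABlock k × IsABlock l) ⊎ (IsBBlock k × IsBBlock l)

  same-kind : ∀ k l → k ≢ l → SameKind k l → ∣ k ∩ l ∣ ≡ n ∸ 2
  -- Equal indices would give equal blocks, so `k ≢ l` yields `i ≢ j`.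
  same-kind _ _ k≢l (inj₁ ((i , refl) , (j , refl))) = ∣A-block∩A-block∣ φ S (k≢l ∘ cong A-block)
  same-kind _ _ k≢l (inj₂ ((i , refl) , (j , refl))) = ∣B-block∩B-block∣ φ S (k≢l ∘ cong B-block)

  size : ∀ k l → Block k → Block l → k ≢ l → ∣ k ∩ l ∣ ∈ 0 ∷ 1 ∷ 2 ∷ (n ∸ 2) ∷ []
  -- Pairs of the same kind take the last entry, even when `n` is 3 or 4 and it repeats an earlier
  -- one.
  size k l (inj₁ kA) (inj₁ lA) k≢l = there (there (there (here (same-kind k l k≢l (inj₁ (kA , lA))))))
  size k l (inj₂ kB) (inj₂ lB) k≢l = there (there (there (here (same-kind k l k≢l (inj₂ (kB , lB))))))
  size _ _ (inj₁ (i , refl)) (inj₂ (j , refl)) _ = ∣A-block∩B-block∣∈ φ S i j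
  -- The count is known with the A-block first, so the intersection is commuted.
  size k l (inj₂ (j , refl)) (inj₁ (i , refl)) _ =
    subst (λ p → ∣ p ∣ ∈ _) (∩-comm l k) (∣A-block∩B-block∣∈ φ S i j)

  mixed : ∀ k l → Block k → Block l → ¬ SameKind k l →
    ∃₂ λ i j → (k ≡ A-block i × l ≡ B-block j) ⊎ (l ≡ A-block i × k ≡ B-block j)
  mixed _ _ (inj₁ kA)         (inj₁ lA)         ¬same = contradiction (inj₁ (kA , lA)) ¬same
  mixed _ _ (inj₂ kB)         (inj₂ lB)         ¬same = contradiction (inj₂ (kB , lB)) ¬same
  mixed _ _ (inj₁ (i , k≡Ai)) (inj₂ (j , l≡Bj)) _     = i , j , inj₁ (k≡Ai , l≡Bj)
  mixed _ _ (inj₂ (j , k≡Bj)) (inj₁ (i , l≡Ai)) _     = i , j , inj₂ (l≡Ai , k≡Bj)
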